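{- For every $C>0$ there exists $c>0$ such that the following holds. If $d\geq 2$ is an integer and $D$ is a finite $(C,d)$-regular digraph with girth $g$, then $D$ contains a directed path of length at least $\frac{c\,d\,g}{\log d}$.
   Context: A digraph $D$ is $(C,d)$-regular if $d^+(v)\geq d$ and $d^-(v)\leq Cd$ for every vertex $v$ (out-degree and in-degree respectively). The girth is the minimum length of a directed cycle. Path length counts arcs. -}

module Defs where

open import Data.Nat using (ℕ; zero; suc; _≤_; _<_; _*_; _+_)
open import Data.Fin using (Fin; zero; suc; inject₁; fromℕ)
open import Data.Bool using (Bool; true; false; if_then_else_; T)
open import Data.List using (List; map; allFin)
open import Data.Nat.ListAction using (sum)
open import Data.Empty using (⊥)
open import Data.Integer using (+_)
open import Data.Rational using (ℚ; _/_) renaming (_≤_ to _≤ℚ_; _*_ to _*ℚ_)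
open import Data.Product using (Σ; _×_; ∃)
open import Function.Definitions using (Injective)
open import Relation.Binary.PropositionalEquality using (_≡_)

record Digraph (n : ℕ) : Set where
  field
    arc : Fin n → Fin n → Bool
open Digraph public

ℕtoℚ : ℕ → ℚ
ℕtoℚ k = + k / 1

outdeg : ∀ {n} → Digraph n → Fin n → ℕ
outdeg {n} D v = sum (map (λ w → if arc D v w then 1 else 0) (allFin n))

indeg : ∀ {n} → Digraph n → Fin n → ℕ
indeg {n} D v = sum (map (λ u → if arc D u v then 1 else 0) (allFin n))

Regular : ∀ {n} → ℚ → ℕ → Digraph n → Set
Regular C d D = ∀ v → (d ≤ outdeg D v) × (ℕtoℚ (indeg D v) ≤ℚ C *ℚ ℕtoℚ d)

IsPath : ∀ {n} → Digraph n → (L : ℕ) → (Fin (suc L) → Fin n) → Set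
IsPath D L p = Injective _≡_ _≡_ p × (∀ (i : Fin L) → T (arc D (p (inject₁ i)) (p (suc i))))

HasPath : ∀ {n} → Digraph n → ℕ → Set
HasPath {n} D L = Σ (Fin (suc L) → Fin n) (IsPath D L)

IsCycle : ∀ {n} → Digraph n → (m : ℕ) → (Fin (suc m) → Fin n) → Set
IsCycle D m p = Injective _≡_ _≡_ p
  × (∀ (i : Fin m) → T (arc D (p (inject₁ i)) (p (suc i))))
  × T (arc D (p (fromℕ m)) (p zero))

HasCycleOfLength : ∀ {n} → Digraph n → ℕ → Set
HasCycleOfLength D zero = ⊥
HasCycleOfLength {n} D (suc m) = Σ (Fin (suc m) → Fin n) (IsCycle D m)

Girth : ∀ {n} → Digraph n → ℕ → Set
Girth D g = HasCycleOfLength D g × (∀ k → HasCycleOfLength D k → g ≤ k)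

{-# OPTIONS --safe #-}
module Submission where

-- Let k be about d / log d. By the Lovász local lemma the vertices can be coloured with k
-- colours so that every vertex has an out-neighbour of every colour: keep exactly d out-arcs
-- at each vertex, so that the event "v misses some colour" has probability at most
-- k (1 - 1/k)^d and depends on at most C d² other such events. Now walk through g vertices of
-- the first colour, then g vertices of the second one, and so on. Two equal vertices of the
-- walk would have the same colour, hence be less than g steps apart and give a cycle shorter
-- than g. So the walk is a path with k g vertices.

open import Defs
open import Data.Bool using (Bool; true; false; T; if_then_else_)
open import Data.Bool.Properties using (T-≡)
open import Data.Empty using (⊥; ⊥-elim)
open import Data.Fin using (Fin; zero; suc; toℕ; inject₁; fromℕ)
open import Data.Fin.Properties using (toℕ-inject₁; toℕ-fromℕ; toℕ-fromℕ<; toℕ<n; toℕ-injective; any?) renaming (_≟_ to _≟ᶠ_; _<?_ to _<ᶠ?_; <-cmp to <ᶠ-cmp; suc-injective to sucᶠ-injective)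
open import Data.Integer as ℤ using (-[1+_]; ∣_∣)
import Data.Integer.Properties as ℤ
open import Data.List using (List; []; _∷_; _++_; map; length; allFin; tabulate; partition)
open import Data.List.Membership.Propositional using (_∈_)
open import Data.List.Membership.Propositional.Properties using (∈-allFin)
open import Data.List.Properties using (map-++; map-tabulate)
open import Data.List.Relation.Binary.Permutation.Propositional using (_↭_; ↭ₛ⇒↭)
open import Data.List.Relation.Binary.Permutation.Propositional.Properties using (map⁺; ↭-length)
import Data.List.Relation.Binary.Permutation.Setoid.Properties as Permutationₛ
open import Data.List.Relation.Unary.All as All using (All; []; _∷_)
open import Data.List.Relation.Unary.All.Properties using (partition-All)
open import Data.List.Relation.Unary.Any using (here; there)
open import Data.Nat using (ℕ; zero; suc; pred; _+_; _*_; _∸_; _^_; _≤_; _<_; z≤n; s≤s; z<s; >-nonZero)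
open import Data.Nat.DivMod using (_/_; _%_; _mod_; m≡m%n+[m/n]*n; m%n<n; m/n*n≤m; m<n⇒m%n≡m; m<n*o⇒m/o<n)
open import Data.Nat.Induction using (<-rec)
open import Data.Nat.ListAction using (product) renaming (sum to sumᴸ)
open import Data.Nat.ListAction.Properties using (sum-++; sum-↭; product-++; product-↭)
open import Data.Nat.Properties
open import Data.Nat.Tactic.RingSolver using (solve-∀)
open import Data.Product using (Σ; _×_; ∃; _,_; proj₁; proj₂)
open import Data.Rational as ℚ using (ℚ; 0ℚ; mkℚ) renaming (_<_ to _<ℚ_)
import Data.Rational.Properties as ℚ
import Data.Rational.Unnormalised as ℚᵘ
import Data.Rational.Unnormalised.Properties as ℚᵘ
open import Data.Sum using (inj₁; inj₂)
open import Data.Vec.Functional using () renaming (_∷_ to _∷ᶠ_)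
open import Function using (_∘_; id; Equivalence)
open import Relation.Binary.Definitions using (tri<; tri≈; tri>)
open import Relation.Binary.PropositionalEquality using (_≡_; _≢_; refl; sym; trans; cong; cong₂; subst; subst₂; setoid; module ≡-Reasoning)
open import Relation.Nullary using (yes; no; does; ¬?; contradiction; _×-dec_)
open import Relation.Nullary.Decidable using (decidable-stable)
open import Algebra.Properties.Semiring.Sum +-*-semiring using (sum; sum-cong-≗; sum-replicate-zero; ∑-distrib-+; ∑-comm; *-distribˡ-sum; *-distribʳ-sum)
open import Algebra.Properties.CommutativeMonoid.Sum *-1-commutativeMonoid using () renaming (sum to ∏; sum-cong-≗ to ∏-cong-≗)

-- Powers

m+m≡2*m : ∀ m → m + m ≡ 2 * m
m+m≡2*m = solve-∀

^-distribʳ-* : ∀ a b n → (a * b) ^ n ≡ a ^ n * b ^ n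
^-distribʳ-* a b zero    = refl
^-distribʳ-* a b (suc n) = trans (cong (a * b *_) (^-distribʳ-* a b n)) (lemma a b (a ^ n) (b ^ n))
  where
  lemma : ∀ a b x y → a * b * (x * y) ≡ a * x * (b * y)
  lemma = solve-∀

-- Mean value bound: from `q` to `suc q` the power grows by at most its derivative at the upper end.
[1+q]^1+m≤ : ∀ q m → suc q ^ suc m ≤ q ^ suc m + suc m * suc q ^ m
[1+q]^1+m≤ q zero    = ≤-reflexive (lemma q)
  where
  lemma : ∀ q → (1 + q) * 1 ≡ q * 1 + 1 * 1
  lemma = solve-∀
[1+q]^1+m≤ q (suc m) = begin
  suc q * suc q ^ suc m                                             ≡⟨⟩
  suc q ^ suc m + q * suc q ^ suc m                                 ≤⟨ +-monoʳ-≤ (suc q ^ suc m) (*-monoʳ-≤ q ([1+q]^1+m≤ q m)) ⟩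
  suc q ^ suc m + q * (q ^ suc m + suc m * suc q ^ m)               ≤⟨ +-monoʳ-≤ (suc q ^ suc m) (m≤m+n _ (suc m * suc q ^ m)) ⟩
  suc q ^ suc m + (q * (q ^ suc m + suc m * suc q ^ m) + suc m * suc q ^ m)
                                                                    ≡⟨ lemma q (q ^ suc m) (suc q ^ m) m ⟩
  q * q ^ suc m + suc (suc m) * suc q ^ suc m                       ∎
  where
  open ≤-Reasoning
  lemma : ∀ q x y m → (1 + q) * y + (q * (x + (1 + m) * y) + (1 + m) * y) ≡ q * x + (2 + m) * ((1 + q) * y)
  lemma = solve-∀

-- The left side consists of the first two terms of the binomial expansion.
≤[1+q]^1+m : ∀ q m → q ^ suc m + suc m * q ^ m ≤ suc q ^ suc m
≤[1+q]^1+m q zero    = ≤-reflexive (lemma q)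
  where
  lemma : ∀ q → q * 1 + 1 * 1 ≡ (1 + q) * 1
  lemma = solve-∀
≤[1+q]^1+m q (suc m) = begin
  q * q ^ suc m + suc (suc m) * q ^ suc m                           ≤⟨ m≤m+n _ (suc m * q ^ m) ⟩
  q * q ^ suc m + suc (suc m) * q ^ suc m + suc m * q ^ m           ≡⟨ lemma q (q ^ m) m ⟩
  suc q * (q ^ suc m + suc m * q ^ m)                               ≤⟨ *-monoʳ-≤ (suc q) (≤[1+q]^1+m q m) ⟩
  suc q * suc q ^ suc m                                             ∎
  where
  open ≤-Reasoning
  lemma : ∀ q y m → q * (q * y) + (2 + m) * (q * y) + (1 + m) * y ≡ (1 + q) * (q * y + (1 + m) * y)
  lemma = solve-∀

-- (1 - 1/2m)^m ≥ 1/2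
[2m]^m≤2*[2m-1]^m : ∀ q m → suc q ≡ 2 * m → suc q ^ m ≤ 2 * q ^ m
[2m]^m≤2*[2m-1]^m q (suc m) eq = +-cancelʳ-≤ (suc q ^ suc m) _ _ (begin
  suc q ^ suc m + suc q ^ suc m                ≡⟨ m+m≡2*m (suc q ^ suc m) ⟩
  2 * suc q ^ suc m                            ≤⟨ *-monoʳ-≤ 2 ([1+q]^1+m≤ q m) ⟩
  2 * (q ^ suc m + suc m * suc q ^ m)          ≡⟨ lemma (q ^ suc m) m (suc q ^ m) ⟩
  2 * q ^ suc m + 2 * suc m * suc q ^ m        ≡⟨ cong (λ z → 2 * q ^ suc m + z * suc q ^ m) eq ⟨
  2 * q ^ suc m + suc q ^ suc m                ∎)
  where
  open ≤-Reasoning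
  lemma : ∀ x m y → 2 * (x + (1 + m) * y) ≡ 2 * x + 2 * (1 + m) * y
  lemma = solve-∀

-- (1 - 1/(j+1))^(j+1) ≤ 1/2
2*j^[1+j]≤[1+j]^[1+j] : ∀ j → 2 * j ^ suc j ≤ suc j ^ suc j
2*j^[1+j]≤[1+j]^[1+j] j = begin
  2 * j ^ suc j                    ≤⟨ m≤m+n _ (j ^ j) ⟩
  2 * j ^ suc j + j ^ j            ≡⟨ lemma j (j ^ j) ⟩
  j ^ suc j + suc j * j ^ j        ≤⟨ ≤[1+q]^1+m j j ⟩
  suc j ^ suc j                    ∎
  where
  open ≤-Reasoning
  lemma : ∀ j y → 2 * (j * y) + y ≡ j * y + (1 + j) * y
  lemma = solve-∀

-- The `s`-th power of `p ^ m ≤ 2 * q ^ m` is the claim with `m * s` in place of `e`; since `q ≤ p`,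
-- the `r` surplus factors can be cancelled.
p^e≤2^s*q^e : ∀ {p q} m s e → 0 < q → q ≤ p → p ^ m ≤ 2 * q ^ m → e ≤ m * s → p ^ e ≤ 2 ^ s * q ^ e
p^e≤2^s*q^e {p} {q} m s e 0<q q≤p p^m≤ e≤ms =
  *-cancelʳ-≤ (p ^ e) (2 ^ s * q ^ e) (q ^ r) {{m^n≢0 q r {{>-nonZero 0<q}}}} (begin
  p ^ e * q ^ r             ≤⟨ *-monoʳ-≤ (p ^ e) (^-monoˡ-≤ r q≤p) ⟩
  p ^ e * p ^ r             ≡⟨ ^-distribˡ-+-* p e r ⟨
  p ^ (e + r)               ≡⟨ cong (p ^_) (m+[n∸m]≡n e≤ms) ⟩
  p ^ (m * s)               ≡⟨ ^-*-assoc p m s ⟨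
  (p ^ m) ^ s               ≤⟨ ^-monoˡ-≤ s p^m≤ ⟩
  (2 * q ^ m) ^ s           ≡⟨ ^-distribʳ-* 2 (q ^ m) s ⟩
  2 ^ s * (q ^ m) ^ s       ≡⟨ cong (2 ^ s *_) (^-*-assoc q m s) ⟩
  2 ^ s * q ^ (m * s)       ≡⟨ cong (λ z → 2 ^ s * q ^ z) (m+[n∸m]≡n e≤ms) ⟨
  2 ^ s * q ^ (e + r)       ≡⟨ cong (2 ^ s *_) (^-distribˡ-+-* q e r) ⟩
  2 ^ s * (q ^ e * q ^ r)   ≡⟨ *-assoc (2 ^ s) _ _ ⟨
  2 ^ s * q ^ e * q ^ r     ∎)
  where
  open ≤-Reasoning
  r = m * s ∸ e

-- Each of `t` blocks of `k` factors gains a factor 2; the `r` factors left over only need `j ≤ k`.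
2^t*j^d≤[1+j]^d : ∀ j t d → suc j * t ≤ d → 2 ^ t * j ^ d ≤ suc j ^ d
2^t*j^d≤[1+j]^d j t d kt≤d = begin
  2 ^ t * j ^ d                          ≡⟨ cong (λ z → 2 ^ t * j ^ z) (m+[n∸m]≡n kt≤d) ⟨
  2 ^ t * j ^ (k * t + r)                ≡⟨ cong (2 ^ t *_) (^-distribˡ-+-* j (k * t) r) ⟩
  2 ^ t * (j ^ (k * t) * j ^ r)          ≡⟨ *-assoc (2 ^ t) _ _ ⟨
  2 ^ t * j ^ (k * t) * j ^ r            ≡⟨ cong (λ z → 2 ^ t * z * j ^ r) (^-*-assoc j k t) ⟨
  2 ^ t * (j ^ k) ^ t * j ^ r            ≡⟨ cong (_* j ^ r) (^-distribʳ-* 2 (j ^ k) t) ⟨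
  (2 * j ^ k) ^ t * j ^ r                ≤⟨ *-mono-≤ (^-monoˡ-≤ t (2*j^[1+j]≤[1+j]^[1+j] j)) (^-monoˡ-≤ r (n≤1+n j)) ⟩
  (k ^ k) ^ t * k ^ r                    ≡⟨ cong (_* k ^ r) (^-*-assoc k k t) ⟩
  k ^ (k * t) * k ^ r                    ≡⟨ ^-distribˡ-+-* k (k * t) r ⟨
  k ^ (k * t + r)                        ≡⟨ cong (k ^_) (m+[n∸m]≡n kt≤d) ⟩
  k ^ d                                  ∎
  where
  open ≤-Reasoning
  k = suc j
  r = d ∸ k * t

-- Binary logarithms and the number of colours

floor-log₂ : ∀ d → ∃ λ ℓ → 2 ^ ℓ ≤ suc d × suc d < 2 ^ suc ℓ
floor-log₂ zero    = 0 , ≤-refl , ≤-refl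
floor-log₂ (suc d) with floor-log₂ d
... | ℓ , lo , hi with suc (suc d) <? 2 ^ suc ℓ
... | yes hi′ = ℓ , m≤n⇒m≤1+n lo , hi′
... | no  ≮   = suc ℓ , ≮⇒≥ ≮ , ≤-trans (s≤s hi) (≤-trans (+-monoˡ-≤ (2 ^ suc ℓ) (m^n>0 2 (suc ℓ))) (≤-reflexive (m+m≡2*m (2 ^ suc ℓ))))

n<2^n : ∀ n → n < 2 ^ n
n<2^n zero    = z<s
n<2^n (suc n) = ≤-trans (+-mono-≤ (m^n>0 2 n) (n<2^n n)) (≤-reflexive (m+m≡2*m (2 ^ n)))

-- Take k = max 1 ⌊d / t⌋ colours with t = (8 + a) ℓ: since d < 2 ^ (1 + ℓ) and ℓ ≥ 1, the factor
-- 4 * 2^a * d² * k is at most 2 ^ (2 + a + 3 (1 + ℓ)) ≤ 2 ^ t, while (1 - 1/k)^d ≤ 2 ^ (- t).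
number-of-colours : ∀ a d → 2 ≤ d → ∃ λ ℓ → ∃ λ j →
  2 ^ ℓ ≤ d × d ≤ 2 * (8 + a) * ℓ * suc j ×
  2 * (2 * (d * (2 ^ a * d))) * (suc j * j ^ d) ≤ suc j ^ d
number-of-colours a (suc d′) 2≤d with floor-log₂ d′
... | zero   , lo , hi = ⊥-elim (<⇒≱ hi 2≤d)
... | suc l  , lo , hi = ℓ , go (d / t) refl
  where
  d = suc d′
  ℓ = suc l
  t = (8 + a) * ℓ
  open ≤-Reasoning
  large : ∀ k → 1 ≤ k → d / t ≤ k → d ≤ 2 * (8 + a) * ℓ * k
  large k 1≤k d/t≤k = begin
    d                      ≡⟨ m≡m%n+[m/n]*n d t ⟩
    _                      ≤⟨ +-mono-≤ (<⇒≤ (m%n<n d t)) (*-monoˡ-≤ t d/t≤k) ⟩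
    t + k * t              ≡⟨ cong (_+ k * t) (*-identityˡ t) ⟨
    1 * t + k * t          ≤⟨ +-monoˡ-≤ (k * t) (*-monoˡ-≤ t 1≤k) ⟩
    k * t + k * t          ≡⟨ lemma a ℓ k ⟩
    2 * (8 + a) * ℓ * k    ∎
    where
    lemma : ∀ a l k → k * ((8 + a) * l) + k * ((8 + a) * l) ≡ 2 * (8 + a) * l * k
    lemma = solve-∀
  exponent : 2 + a + 3 * (1 + ℓ) ≤ t
  exponent = ≤-trans (m≤m+n _ (5 * l + a * l)) (≤-reflexive (lemma a l))
    where
    lemma : ∀ a l → 2 + a + 3 * (2 + l) + (5 * l + a * l) ≡ (8 + a) * (1 + l)
    lemma = solve-∀
  go : ∀ x → d / t ≡ x → ∃ λ j → 2 ^ ℓ ≤ d × d ≤ 2 * (8 + a) * ℓ * suc j ×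
         2 * (2 * (d * (2 ^ a * d))) * (suc j * j ^ d) ≤ suc j ^ d
  -- Here `d < t` and a single colour is used: `j = 0`, and `0 ^ d` vanishes because `d` is a
  -- successor.
  go zero    eq = 0 , lo , large 1 ≤-refl (≤-trans (≤-reflexive eq) z≤n) , ≤-trans (≤-reflexive (*-zeroʳ (2 * (2 * (d * (2 ^ a * d)))))) z≤n
  go (suc j) eq = j , lo , large k (s≤s z≤n) (≤-reflexive eq) , bound
    where
    k = suc j
    kt≤d : k * t ≤ d
    kt≤d = subst (λ z → z * t ≤ d) eq (m/n*n≤m d t)
    k≤d : k ≤ d
    k≤d = ≤-trans (m≤m*n k t) kt≤d
    d≤ : d ≤ 2 ^ suc ℓ
    d≤ = <⇒≤ hi
    bound : 2 * (2 * (d * (2 ^ a * d))) * (k * j ^ d) ≤ k ^ d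
    bound = begin
      2 * (2 * (d * (2 ^ a * d))) * (k * j ^ d)   ≡⟨ lemma d (2 ^ a) k (j ^ d) ⟩
      2 ^ 2 * 2 ^ a * (d * (d * (k * 1))) * j ^ d
        ≤⟨ *-monoˡ-≤ (j ^ d) (*-monoʳ-≤ (2 ^ 2 * 2 ^ a) (*-mono-≤ d≤ (*-mono-≤ d≤ (*-monoˡ-≤ 1 (≤-trans k≤d d≤))))) ⟩
      2 ^ 2 * 2 ^ a * (2 ^ suc ℓ) ^ 3 * j ^ d
        ≡⟨ cong (λ z → 2 ^ 2 * 2 ^ a * z * j ^ d) (trans (^-*-assoc 2 (suc ℓ) 3) (cong (2 ^_) (*-comm (suc ℓ) 3))) ⟩
      2 ^ 2 * 2 ^ a * 2 ^ (3 * suc ℓ) * j ^ d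
        ≡⟨ cong (λ z → z * 2 ^ (3 * suc ℓ) * j ^ d) (^-distribˡ-+-* 2 2 a) ⟨
      2 ^ (2 + a) * 2 ^ (3 * suc ℓ) * j ^ d
        ≡⟨ cong (_* j ^ d) (^-distribˡ-+-* 2 (2 + a) (3 * suc ℓ)) ⟨
      2 ^ (2 + a + 3 * suc ℓ) * j ^ d       ≤⟨ *-monoˡ-≤ (j ^ d) (^-monoʳ-≤ 2 exponent) ⟩
      2 ^ t * j ^ d                         ≤⟨ 2^t*j^d≤[1+j]^d j t d kt≤d ⟩
      k ^ d                                 ∎
      where
      lemma : ∀ d x k y → 2 * (2 * (d * (x * d))) * (k * y) ≡ 2 ^ 2 * x * (d * (d * (k * 1))) * y
      lemma = solve-∀

-- Sums and products over finite sets

indicator : Bool → ℕ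
indicator b = if b then 1 else 0

sum-mono-≤ : ∀ {n} {f g : Fin n → ℕ} → (∀ i → f i ≤ g i) → sum f ≤ sum g
sum-mono-≤ {zero}  f≤g = z≤n
sum-mono-≤ {suc n} f≤g = +-mono-≤ (f≤g zero) (sum-mono-≤ (f≤g ∘ suc))

sum-const : ∀ n x → sum {n} (λ _ → x) ≡ n * x
sum-const zero    x = refl
sum-const (suc n) x = cong (x +_) (sum-const n x)

sum≡0⇒≡0 : ∀ {n} (f : Fin n → ℕ) → sum f ≡ 0 → ∀ i → f i ≡ 0
sum≡0⇒≡0 f eq zero    = m+n≡0⇒m≡0 (f zero) eq
sum≡0⇒≡0 f eq (suc i) = sum≡0⇒≡0 (f ∘ suc) (m+n≡0⇒n≡0 (f zero) eq) i

sum>0⇒∃>0 : ∀ {n} (f : Fin n → ℕ) → 0 < sum f → ∃ λ i → 0 < f i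
sum>0⇒∃>0 {suc n} f pos with f zero in eq
... | suc _ = zero , subst (0 <_) (sym eq) z<s
... | zero  = let i , fi>0 = sum>0⇒∃>0 (f ∘ suc) pos in suc i , fi>0

∏≡0⇒∃≡0 : ∀ {n} (f : Fin n → ℕ) → ∏ f ≡ 0 → ∃ λ i → f i ≡ 0
∏≡0⇒∃≡0 {suc n} f eq with m*n≡0⇒m≡0∨n≡0 (f zero) eq
... | inj₁ f0≡0 = zero , f0≡0
... | inj₂ eq′  = let i , fi≡0 = ∏≡0⇒∃≡0 (f ∘ suc) eq′ in suc i , fi≡0

m*n>0⇒m>0×n>0 : ∀ m n → 0 < m * n → 0 < m × 0 < n
m*n>0⇒m>0×n>0 (suc m) zero    pos = ⊥-elim (<⇒≢ pos (sym (*-zeroʳ m)))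
m*n>0⇒m>0×n>0 (suc m) (suc n) pos = z<s , z<s

∏>0⇒>0 : ∀ {n} (f : Fin n → ℕ) → 0 < ∏ f → ∀ i → 0 < f i
∏>0⇒>0 f pos zero    = proj₁ (m*n>0⇒m>0×n>0 (f zero) _ pos)
∏>0⇒>0 f pos (suc i) = ∏>0⇒>0 (f ∘ suc) (proj₂ (m*n>0⇒m>0×n>0 (f zero) _ pos)) i

∏≤1 : ∀ {n} (f : Fin n → ℕ) → (∀ i → f i ≤ 1) → ∏ f ≤ 1
∏≤1 {zero}  f f≤1 = ≤-refl
∏≤1 {suc n} f f≤1 = *-mono-≤ (f≤1 zero) (∏≤1 (f ∘ suc) (f≤1 ∘ suc))

product>0⇒>0 : ∀ {A : Set} (f : A → ℕ) xs → 0 < product (map f xs) → ∀ {x} → x ∈ xs → 0 < f x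
product>0⇒>0 f (x ∷ xs) pos (here refl) = proj₁ (m*n>0⇒m>0×n>0 (f x) _ pos)
product>0⇒>0 f (x ∷ xs) pos (there x∈)  = product>0⇒>0 f xs (proj₂ (m*n>0⇒m>0×n>0 (f x) _ pos)) x∈

product≤1 : ∀ {A : Set} (f : A → ℕ) → (∀ x → f x ≤ 1) → ∀ xs → product (map f xs) ≤ 1
product≤1 f f≤1 []       = ≤-refl
product≤1 f f≤1 (x ∷ xs) = *-mono-≤ (f≤1 x) (product≤1 f f≤1 xs)

sum-allFin : ∀ n (f : Fin n → ℕ) → sumᴸ (map f (allFin n)) ≡ sum f
sum-allFin n f = trans (cong sumᴸ (map-tabulate id f)) (sum-tabulate n f)
  where
  sum-tabulate : ∀ n (f : Fin n → ℕ) → sumᴸ (tabulate f) ≡ sum f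
  sum-tabulate zero    f = refl
  sum-tabulate (suc n) f = cong (f zero +_) (sum-tabulate n (f ∘ suc))

-- The union bound: the product is 1 if all m i vanish, and otherwise the sum is positive.
1≤∏[1∸m]+∑m : ∀ {k} (m : Fin k → ℕ) → 1 ≤ ∏ (λ i → 1 ∸ m i) + sum m
1≤∏[1∸m]+∑m {zero}  m = ≤-refl
1≤∏[1∸m]+∑m {suc k} m with m zero
... | zero  = subst (λ z → 1 ≤ z + sum (m ∘ suc)) (sym (*-identityˡ (∏ (λ i → 1 ∸ m (suc i))))) (1≤∏[1∸m]+∑m (m ∘ suc))
... | suc x = ≤-trans (s≤s z≤n) (m≤n+m (suc x + sum (m ∘ suc)) _)

-- One factor of the indicator that colour `i` is absent from a set of vertices; `b` tells whether
-- the vertex belongs to the set.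
avoids : ∀ {k} → Bool → Fin k → Fin k → ℕ
avoids b i c = if b then (if does (c ≟ᶠ i) then 0 else 1) else 1

sum-avoids : ∀ j (i : Fin (suc j)) → sum (avoids true i) ≡ j
sum-avoids j       zero    = trans (sum-const j 1) (*-identityʳ j)
sum-avoids (suc j) (suc i) = cong suc (sum-avoids j i)

size : ∀ {n} → (Fin n → Bool) → ℕ
size T = sum (indicator ∘ T)

-- The size of the intersection, written as a sum of products so that overlaps can be double
-- counted.
shared : ∀ {n} → (Fin n → Bool) → (Fin n → Bool) → ℕ
shared T U = sum (λ w → indicator (T w) * indicator (U w))

-- The local lemma, by counting colourings

module Colourings (j : ℕ) where

  k : ℕ
  k = suc j

  Colouring : ℕ → Set
  Colouring n = Fin n → Fin k

  slice : ∀ {n} → (Colouring (suc n) → ℕ) → Fin k → Colouring n → ℕ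
  slice f c φ = f (c ∷ᶠ φ)

  -- The expectation over uniform colourings, multiplied by `k ^ n`; totals instead of means keep
  -- the probabilistic argument within ℕ.
  ∑ᶜ : ∀ n → (Colouring n → ℕ) → ℕ
  ∑ᶜ zero    f = f (λ ())
  ∑ᶜ (suc n) f = sum (λ c → ∑ᶜ n (slice f c))

  ∑ᶜ-mono-≤ : ∀ n {f g} → (∀ φ → f φ ≤ g φ) → ∑ᶜ n f ≤ ∑ᶜ n g
  ∑ᶜ-mono-≤ zero    f≤g = f≤g _
  ∑ᶜ-mono-≤ (suc n) f≤g = sum-mono-≤ (λ c → ∑ᶜ-mono-≤ n (λ φ → f≤g (c ∷ᶠ φ)))

  ∑ᶜ-cong : ∀ n {f g} → (∀ φ → f φ ≡ g φ) → ∑ᶜ n f ≡ ∑ᶜ n g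
  ∑ᶜ-cong zero    f≡g = f≡g _
  ∑ᶜ-cong (suc n) f≡g = sum-cong-≗ (λ c → ∑ᶜ-cong n (λ φ → f≡g (c ∷ᶠ φ)))

  ∑ᶜ-distrib-+ : ∀ n f g → ∑ᶜ n (λ φ → f φ + g φ) ≡ ∑ᶜ n f + ∑ᶜ n g
  ∑ᶜ-distrib-+ zero    f g = refl
  ∑ᶜ-distrib-+ (suc n) f g = trans
    (sum-cong-≗ {k} (λ c → ∑ᶜ-distrib-+ n (slice f c) (slice g c)))
    (∑-distrib-+ {k} (λ c → ∑ᶜ n (slice f c)) (λ c → ∑ᶜ n (slice g c)))

  *-distribˡ-∑ᶜ : ∀ n x f → x * ∑ᶜ n f ≡ ∑ᶜ n (λ φ → x * f φ)
  *-distribˡ-∑ᶜ zero    x f = refl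
  *-distribˡ-∑ᶜ (suc n) x f = trans
    (*-distribˡ-sum {k} x (λ c → ∑ᶜ n (slice f c)))
    (sum-cong-≗ {k} (λ c → *-distribˡ-∑ᶜ n x (slice f c)))

  ∑ᶜ-sum-comm : ∀ n {m} (f : Fin m → Colouring n → ℕ) → ∑ᶜ n (λ φ → sum (λ i → f i φ)) ≡ sum (λ i → ∑ᶜ n (f i))
  ∑ᶜ-sum-comm zero    f = refl
  ∑ᶜ-sum-comm (suc n) f = trans
    (sum-cong-≗ {k} (λ c → ∑ᶜ-sum-comm n (λ i → slice (f i) c)))
    (∑-comm {k} (λ c i → ∑ᶜ n (slice (f i) c)))

  ∑ᶜ>0⇒∃>0 : ∀ n f → 0 < ∑ᶜ n f → ∃ λ φ → 0 < f φ
  ∑ᶜ>0⇒∃>0 zero    f pos = _ , pos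
  ∑ᶜ>0⇒∃>0 (suc n) f pos =
    let c , pos′ = sum>0⇒∃>0 {k} (λ c → ∑ᶜ n (slice f c)) pos
        φ , pos″ = ∑ᶜ>0⇒∃>0 n (slice f c) pos′
    in c ∷ᶠ φ , pos″

  ∑ᶜ-one>0 : ∀ n → 0 < ∑ᶜ n (λ _ → 1)
  ∑ᶜ-one>0 zero    = z<s
  ∑ᶜ-one>0 (suc n) = ≤-trans (∑ᶜ-one>0 n) (m≤m+n _ _)

  misses : ∀ {n} → (Fin n → Bool) → Fin k → Colouring n → ℕ
  misses T i φ = ∏ (λ w → avoids (T w) i (φ w))

  IndependentOf : ∀ {n} → (Fin n → Bool) → (Colouring n → ℕ) → Set
  IndependentOf T h = ∀ φ ψ → (∀ w → T w ≡ false → φ w ≡ ψ w) → h φ ≡ h ψ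

  -- Independence with denominators cleared: colour `i` is absent from `T` with probability
  -- `(j / k) ^ size T`, also under a weight `h` that depends only on the other vertices.
  ∑ᶜ-misses : ∀ n T i h → IndependentOf T h →
    ∑ᶜ n (λ φ → misses T i φ * h φ) * k ^ size T ≡ j ^ size T * ∑ᶜ n h
  ∑ᶜ-misses zero    T i h indep = *-identityʳ (h (λ ()) + 0)
  ∑ᶜ-misses (suc n) T i h indep = go (T zero) refl
    where
    open ≡-Reasoning
    T′ = T ∘ suc
    s = size T′
    hᶜ : Fin k → Colouring n → ℕ
    hᶜ = slice h
    indep′ : ∀ c → IndependentOf T′ (hᶜ c)
    indep′ c φ ψ agree = indep _ _ λ where
      zero    _  → refl
      (suc w) Tw → agree w Tw
    go : ∀ b → T zero ≡ b →
      ∑ᶜ (suc n) (λ φ → avoids b i (φ zero) * misses T′ i (φ ∘ suc) * h φ) * k ^ (indicator b + s)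
        ≡ j ^ (indicator b + s) * ∑ᶜ (suc n) h
    go false T0 = begin
      sum (λ c → ∑ᶜ n (λ φ → 1 * misses T′ i φ * hᶜ c φ)) * k ^ s
        ≡⟨ cong (_* k ^ s) (sum-cong-≗ {k} (λ c → ∑ᶜ-cong n (λ φ → cong (_* hᶜ c φ) (*-identityˡ (misses T′ i φ))))) ⟩
      sum (λ c → ∑ᶜ n (λ φ → misses T′ i φ * hᶜ c φ)) * k ^ s
        ≡⟨ *-distribʳ-sum {k} (k ^ s) (λ c → ∑ᶜ n (λ φ → misses T′ i φ * hᶜ c φ)) ⟩
      sum (λ c → ∑ᶜ n (λ φ → misses T′ i φ * hᶜ c φ) * k ^ s)
        ≡⟨ sum-cong-≗ {k} (λ c → ∑ᶜ-misses n T′ i (hᶜ c) (indep′ c)) ⟩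
      sum (λ c → j ^ s * ∑ᶜ n (hᶜ c))
        ≡⟨ *-distribˡ-sum {k} (j ^ s) (λ c → ∑ᶜ n (hᶜ c)) ⟨
      j ^ s * sum (λ c → ∑ᶜ n (hᶜ c)) ∎
    -- The first vertex lies in `T`, so `h` does not see its colour: all slices of `h` equal the one
    -- at colour zero, and `j` of the `k` colours avoid `i`.
    go true T0 = begin
      sum (λ c → ∑ᶜ n (λ φ → avoids true i c * misses T′ i φ * hᶜ c φ)) * (k * k ^ s)
        ≡⟨ cong (_* (k * k ^ s)) (sum-cong-≗ {k} (λ c → trans
             (∑ᶜ-cong n (λ φ → trans (*-assoc (avoids true i c) (misses T′ i φ) (hᶜ c φ))
               (cong (λ z → avoids true i c * (misses T′ i φ * z)) (same c φ))))
             (sym (*-distribˡ-∑ᶜ n (avoids true i c) (λ φ → misses T′ i φ * hᶜ zero φ))))) ⟩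
      sum (λ c → avoids true i c * A) * (k * k ^ s)
        ≡⟨ cong (_* (k * k ^ s)) (trans (sym (*-distribʳ-sum {k} A (avoids true i))) (cong (_* A) (sum-avoids j i))) ⟩
      j * A * (k * k ^ s)       ≡⟨ regroup₁ j A k (k ^ s) ⟩
      j * k * (A * k ^ s)       ≡⟨ cong (j * k *_) (∑ᶜ-misses n T′ i (hᶜ zero) (indep′ zero)) ⟩
      j * k * (j ^ s * B)       ≡⟨ regroup₂ j k (j ^ s) B ⟩
      j * j ^ s * (k * B)       ≡⟨ cong (j * j ^ s *_) (sum-const k B) ⟨
      j * j ^ s * sum {k} (λ _ → B)
        ≡⟨ cong (j * j ^ s *_) (sum-cong-≗ {k} (λ c → ∑ᶜ-cong n (λ φ → sym (same c φ)))) ⟩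
      j * j ^ s * sum (λ c → ∑ᶜ n (hᶜ c)) ∎
      where
      A = ∑ᶜ n (λ φ → misses T′ i φ * hᶜ zero φ)
      B = ∑ᶜ n (hᶜ zero)
      same : ∀ c φ → hᶜ c φ ≡ hᶜ zero φ
      same c φ = indep _ _ λ where
        zero    T0≡false → contradiction (trans (sym T0) T0≡false) λ ()
        (suc w) _        → refl
      regroup₁ : ∀ j a k x → j * a * (k * x) ≡ j * k * (a * x)
      regroup₁ = solve-∀
      regroup₂ : ∀ j k x b → j * k * (x * b) ≡ j * x * (k * b)
      regroup₂ = solve-∀

  -- Truncated subtraction makes every factor 0 or 1, so this is the indicator that all colours
  -- occur on `T`.
  hitsAll : ∀ {n} → (Fin n → Bool) → Colouring n → ℕ
  hitsAll T φ = ∏ (λ i → 1 ∸ misses T i φ)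

  hitsAll≤1 : ∀ {n} (T : Fin n → Bool) φ → hitsAll T φ ≤ 1
  hitsAll≤1 T φ = ∏≤1 (λ i → 1 ∸ misses T i φ) (λ i → m∸n≤m 1 (misses T i φ))

  -- Positivity forces `misses T i φ` to be 0, and a vanishing factor of that product is a vertex of
  -- `T` with colour `i`.
  hitsAll>0⇒hits : ∀ {n} (T : Fin n → Bool) φ → 0 < hitsAll T φ → ∀ i → ∃ λ w → T w ≡ true × φ w ≡ i
  hitsAll>0⇒hits T φ pos i = let w , eq = ∏≡0⇒∃≡0 _ misses≡0 in w , hit w eq
    where
    misses≡0 : misses T i φ ≡ 0
    misses≡0 with misses T i φ | ∏>0⇒>0 (λ i → 1 ∸ misses T i φ) pos i
    ... | zero  | _  = refl
    ... | suc m | lt = ⊥-elim (<⇒≢ lt (sym (0∸n≡0 m)))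
    hit : ∀ w → avoids (T w) i (φ w) ≡ 0 → T w ≡ true × φ w ≡ i
    hit w eq with T w | φ w ≟ᶠ i
    hit w eq | true  | yes φw≡i = refl , φw≡i
    hit w () | true  | no _
    hit w () | false | _

  disjoint⇒independent : ∀ {n} (T U : Fin n → Bool) → shared T U ≡ 0 → IndependentOf T (hitsAll U)
  disjoint⇒independent T U eq φ ψ agree = ∏-cong-≗ (λ i → cong (1 ∸_) (∏-cong-≗ (λ w → same i w (sum≡0⇒≡0 _ eq w))))
    where
    same : ∀ i w → indicator (T w) * indicator (U w) ≡ 0 → avoids (U w) i (φ w) ≡ avoids (U w) i (ψ w)
    same i w disj with U w | T w in Tw
    ... | false | _     = refl
    ... | true  | false = cong (avoids true i) (agree w Tw)
    same i w () | true | true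

  -- The symmetric local lemma. `M` is to bound the total overlap of one set with the others, `rare`
  -- makes the failure probability of one vertex at most `1 / (4 M)`, and
  -- `x / suc x = 1 - 1 / (2 M)` is the conditional probability of success to be guaranteed.
  module LocalLemma {n} (T : Fin n → Fin n → Bool) (d M x : ℕ) (sizes : ∀ v → size (T v) ≡ d)
                    (1+x≡2M : suc x ≡ 2 * M) (rare : 2 * suc x * (k * j ^ d) ≤ k ^ d) where

    good : List (Fin n) → Colouring n → ℕ
    good S φ = product (map (λ v → hitsAll (T v) φ) S)

    N : List (Fin n) → ℕ
    N S = ∑ᶜ n (good S)

    sharing : Fin n → List (Fin n) → ℕ
    sharing v S = sumᴸ (map (shared (T v) ∘ T) S)

    Sparse : List (Fin n) → Set
    Sparse S = ∀ v → sharing v S ≤ M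

    N-↭ : ∀ {S S′} → S ↭ S′ → N S ≡ N S′
    N-↭ S↭S′ = ∑ᶜ-cong n (λ φ → product-↭ (map⁺ _ S↭S′))

    Sparse-↭ : ∀ {S S′} → S ↭ S′ → Sparse S → Sparse S′
    Sparse-↭ S↭S′ sparse v = subst (_≤ M) (sum-↭ (map⁺ _ S↭S′)) (sparse v)

    Sparse-tail : ∀ {u S} → Sparse (u ∷ S) → Sparse S
    Sparse-tail {u} sparse v = ≤-trans (m≤n+m _ (shared (T v) (T u))) (sparse v)

    0<x : 0 < x
    0<x = go x M 1+x≡2M
      where
      go : ∀ x M → suc x ≡ 2 * M → 0 < x
      go (suc x) M       eq = z<s
      go zero    (suc M) eq = contradiction (trans eq (cong suc (+-suc M (M + 0)))) λ ()

    length≤sharing : ∀ v A → All (λ u → shared (T v) (T u) ≢ 0) A → length A ≤ sharing v A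
    length≤sharing v []      []         = z≤n
    length≤sharing v (u ∷ A) (u≢0 ∷ as) = +-mono-≤ (n≢0⇒n>0 u≢0) (length≤sharing v A as)

    good-independent : ∀ v B → All (λ u → shared (T v) (T u) ≡ 0) B → IndependentOf (T v) (good B)
    good-independent v []      []         φ ψ agree = refl
    good-independent v (u ∷ B) (u≡0 ∷ bs) φ ψ agree =
      cong₂ _*_ (disjoint⇒independent (T v) (T u) u≡0 φ ψ agree) (good-independent v B bs φ ψ agree)

    -- If all of `S` succeed, `v` succeeds with conditional probability at least `x / suc x`.
    -- Without denominators this makes sense before `N S` is known to be positive.
    Extends : List (Fin n) → Set
    Extends S = ∀ v → x * N S ≤ suc x * N (v ∷ S)

    -- Chain rule: the vertices of `A` are restored one at a time, at the cost of a factor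
    -- `suc x / x` each. Only lists shorter than `m` are passed to `ih`, which is what the induction
    -- in `extend` provides.
    N-prepend : ∀ {m} → (∀ S → length S < m → Sparse S → Extends S) →
      ∀ A B → length (A ++ B) ≤ m → Sparse (A ++ B) → x ^ length A * N B ≤ suc x ^ length A * N (A ++ B)
    N-prepend ih []      B len sparse = ≤-refl
    N-prepend ih (u ∷ A) B len sparse = begin
      x * x ^ l * N B                        ≡⟨ *-assoc x _ _ ⟩
      x * (x ^ l * N B)                      ≤⟨ *-monoʳ-≤ x (N-prepend ih A B (<⇒≤ len) sparse′) ⟩
      x * (suc x ^ l * N (A ++ B))           ≡⟨ swap x (suc x ^ l) (N (A ++ B)) ⟩
      suc x ^ l * (x * N (A ++ B))           ≤⟨ *-monoʳ-≤ (suc x ^ l) (ih (A ++ B) len sparse′ u) ⟩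
      suc x ^ l * (suc x * N (u ∷ A ++ B))   ≡⟨ *-assoc (suc x ^ l) _ _ ⟨
      suc x ^ l * suc x * N (u ∷ A ++ B)     ≡⟨ cong (_* N (u ∷ A ++ B)) (*-comm (suc x ^ l) (suc x)) ⟩
      suc x * suc x ^ l * N (u ∷ A ++ B)     ∎
      where
      open ≤-Reasoning
      l = length A
      sparse′ : Sparse (A ++ B)
      sparse′ = Sparse-tail {u} {A ++ B} sparse
      swap : ∀ a b c → a * (b * c) ≡ b * (a * c)
      swap = solve-∀

    -- If v fails, some colour misses T v, which is independent of the part B of S sharing nothing with T v;
    -- the remaining part A has at most M elements, so that N B ≤ 2 N S.
    extend : ∀ m S → length S < m → Sparse S → Extends S
    -- Adding `N S` to both sides turns `x` into `suc x`; it then suffices that the failures satisfy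
    -- `suc x * R ≤ N S`.
    extend (suc m) S (s≤s len) sparse v = +-cancelʳ-≤ (N S) _ _ (begin
      x * N S + N S                        ≡⟨ +-comm (x * N S) (N S) ⟩
      suc x * N S                          ≤⟨ *-monoʳ-≤ (suc x) union ⟩
      suc x * (N (v ∷ S) + R)              ≡⟨ *-distribˡ-+ (suc x) (N (v ∷ S)) R ⟩
      suc x * N (v ∷ S) + suc x * R        ≤⟨ +-monoʳ-≤ (suc x * N (v ∷ S)) failures ⟩
      suc x * N (v ∷ S) + N S              ∎)
      where
      open ≤-Reasoning
      shares? = λ u → ¬? (shared (T v) (T u) ≟ 0)
      A = proj₁ (partition shares? S)
      B = proj₂ (partition shares? S)
      S↭A++B : S ↭ A ++ B
      S↭A++B = ↭ₛ⇒↭ (Permutationₛ.partition-↭ (setoid (Fin n)) shares? S)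
      A-shares : All (λ u → shared (T v) (T u) ≢ 0) A
      A-shares = proj₁ (partition-All shares? S)
      B-disjoint : All (λ u → shared (T v) (T u) ≡ 0) B
      B-disjoint = All.map (λ {u} → decidable-stable (shared (T v) (T u) ≟ 0)) (proj₂ (partition-All shares? S))
      l = length A
      l≤M : l ≤ M
      l≤M = begin
        l                          ≤⟨ length≤sharing v A A-shares ⟩
        sharing v A                ≤⟨ m≤m+n _ (sharing v B) ⟩
        sharing v A + sharing v B  ≡⟨ sum-++ (map _ A) (map _ B) ⟨
        sumᴸ (map (shared (T v) ∘ T) A ++ map (shared (T v) ∘ T) B)  ≡⟨ cong sumᴸ (map-++ _ A B) ⟨
        sharing v (A ++ B)         ≤⟨ Sparse-↭ S↭A++B sparse v ⟩
        M                          ∎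
      -- Restoring the `l ≤ M` vertices of `A` costs `(suc x / x) ^ l`, at most 2 because
      -- `suc x = 2 * M`.
      N-B : N B ≤ 2 * N S
      N-B = *-cancelˡ-≤ (x ^ l) {{m^n≢0 x l {{>-nonZero 0<x}}}} (begin
        x ^ l * N B                ≤⟨ N-prepend (extend m) A B (subst (_≤ m) (↭-length S↭A++B) len) (Sparse-↭ S↭A++B sparse) ⟩
        suc x ^ l * N (A ++ B)     ≡⟨ cong (suc x ^ l *_) (N-↭ S↭A++B) ⟨
        suc x ^ l * N S            ≤⟨ *-monoˡ-≤ (N S) (p^e≤2^s*q^e M 1 l 0<x (n≤1+n x) ([2m]^m≤2*[2m-1]^m x M 1+x≡2M)
                                        (≤-trans l≤M (≤-reflexive (sym (*-identityʳ M))))) ⟩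
        2 * x ^ l * N S            ≡⟨ regroup (x ^ l) (N S) ⟩
        x ^ l * (2 * N S)          ∎)
        where
        regroup : ∀ a b → 2 * a * b ≡ a * (2 * b)
        regroup = solve-∀
      missB : Fin k → Colouring n → ℕ
      missB i φ = misses (T v) i φ * good B φ
      -- The failures at `v`, summed over the missed colour; success is required only on `B`, where
      -- independence holds.
      R = sum (λ i → ∑ᶜ n (missB i))
      good-S≤good-B : ∀ φ → good S φ ≤ good B φ
      good-S≤good-B φ = begin
        good S φ             ≡⟨ product-↭ (map⁺ _ S↭A++B) ⟩
        good (A ++ B) φ      ≡⟨ trans (cong product (map-++ _ A B)) (product-++ (map _ A) (map _ B)) ⟩
        good A φ * good B φ  ≤⟨ *-monoˡ-≤ (good B φ) (product≤1 _ (λ u → hitsAll≤1 (T u) φ) A) ⟩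
        1 * good B φ         ≡⟨ *-identityˡ _ ⟩
        good B φ             ∎
      union : N S ≤ N (v ∷ S) + R
      union = begin
        N S
          ≤⟨ ∑ᶜ-mono-≤ n pointwise ⟩
        ∑ᶜ n (λ φ → good (v ∷ S) φ + sum (λ i → missB i φ))
          ≡⟨ ∑ᶜ-distrib-+ n (good (v ∷ S)) (λ φ → sum (λ i → missB i φ)) ⟩
        N (v ∷ S) + ∑ᶜ n (λ φ → sum (λ i → missB i φ))
          ≡⟨ cong (N (v ∷ S) +_) (∑ᶜ-sum-comm n missB) ⟩
        N (v ∷ S) + R ∎
        where
        pointwise : ∀ φ → good S φ ≤ good (v ∷ S) φ + sum (λ i → missB i φ)
        pointwise φ = begin
          good S φ
            ≡⟨ *-identityˡ _ ⟨
          1 * good S φ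
            ≤⟨ *-monoˡ-≤ (good S φ) (1≤∏[1∸m]+∑m (λ i → misses (T v) i φ)) ⟩
          (hitsAll (T v) φ + sum (λ i → misses (T v) i φ)) * good S φ
            ≡⟨ *-distribʳ-+ (good S φ) (hitsAll (T v) φ) _ ⟩
          good (v ∷ S) φ + sum (λ i → misses (T v) i φ) * good S φ
            ≤⟨ +-monoʳ-≤ (good (v ∷ S) φ) (*-monoʳ-≤ (sum (λ i → misses (T v) i φ)) (good-S≤good-B φ)) ⟩
          good (v ∷ S) φ + sum (λ i → misses (T v) i φ) * good B φ
            ≡⟨ cong (good (v ∷ S) φ +_) (*-distribʳ-sum {k} (good B φ) (λ i → misses (T v) i φ)) ⟩
          good (v ∷ S) φ + sum (λ i → missB i φ) ∎
      R-exact : R * k ^ d ≡ k * (j ^ d * N B)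
      R-exact = subst (λ e → R * k ^ e ≡ k * (j ^ e * N B)) (sizes v)
        (trans (*-distribʳ-sum {k} (k ^ size (T v)) (λ i → ∑ᶜ n (missB i)))
        (trans (sum-cong-≗ {k} (λ i → ∑ᶜ-misses n (T v) i (good B) (good-independent v B B-disjoint)))
               (sum-const k _)))
      -- The factor 2 lost in `N-B` is the leading 2 in `rare`.
      failures : suc x * R ≤ N S
      failures = *-cancelʳ-≤ _ _ (k ^ d) {{m^n≢0 k d}} (begin
        suc x * R * k ^ d                  ≡⟨ *-assoc (suc x) R _ ⟩
        suc x * (R * k ^ d)                ≡⟨ cong (suc x *_) R-exact ⟩
        suc x * (k * (j ^ d * N B))        ≤⟨ *-monoʳ-≤ (suc x) (*-monoʳ-≤ k (*-monoʳ-≤ (j ^ d) N-B)) ⟩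
        suc x * (k * (j ^ d * (2 * N S)))  ≡⟨ regroup (suc x) k (j ^ d) (N S) ⟩
        N S * (2 * suc x * (k * j ^ d))    ≤⟨ *-monoʳ-≤ (N S) rare ⟩
        N S * k ^ d                        ∎)
        where
        regroup : ∀ a b c e → a * (b * (c * (2 * e))) ≡ e * (2 * a * (b * c))
        regroup = solve-∀

    -- The empty list admits every colouring, and each added vertex keeps a positive proportion
    -- since `x > 0`.
    N>0 : ∀ S → Sparse S → 0 < N S
    N>0 []      sparse = ∑ᶜ-one>0 n
    N>0 (v ∷ S) sparse = proj₂ (m*n>0⇒m>0×n>0 (suc x) _
      (≤-trans (*-mono-≤ 0<x (N>0 S sparse′)) (extend (suc (length S)) S ≤-refl sparse′ v)))
      where
      sparse′ : Sparse S
      sparse′ = Sparse-tail {v} {S} sparse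

    exists-colouring : (∀ v → sum (λ u → shared (T v) (T u)) ≤ M) →
      ∃ λ (φ : Colouring n) → ∀ v i → ∃ λ w → T v w ≡ true × φ w ≡ i
    exists-colouring sparse =
      let φ , pos = ∑ᶜ>0⇒∃>0 n (good (allFin n)) (N>0 (allFin n) (λ v → subst (_≤ M) (sym (sum-allFin n _)) (sparse v)))
      in φ , λ v → hitsAll>0⇒hits (T v) φ (product>0⇒>0 _ (allFin n) pos (∈-allFin v))

-- Walks, cycles and paths

-- The denominator of `C` is at least 1, so the absolute value of the numerator is a natural number
-- bounding `C`.
ℕtoℚ-bound : ∀ C m d → ℕtoℚ m ℚ.≤ C ℚ.* ℕtoℚ d → m ≤ ∣ ℚ.numerator C ∣ * d
ℕtoℚ-bound C@(mkℚ c e-1 _) m d m≤Cd = ℤ.drop‿+≤+ (ℤ.≤-trans step (ℤ.≤-trans step′ (ℤ.≤-reflexive (sym (ℤ.pos-* ∣ c ∣ d)))))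
  where
  unnormalised : ℚᵘ.mkℚᵘ (ℤ.+ m) 0 ℚᵘ.≤ ℚᵘ.mkℚᵘ c e-1 ℚᵘ.* ℚᵘ.mkℚᵘ (ℤ.+ d) 0
  unnormalised = ℚᵘ.≤-respˡ-≃ (ℚ.toℚᵘ-fromℚᵘ (ℚᵘ.mkℚᵘ (ℤ.+ m) 0))
    (ℚᵘ.≤-respʳ-≃ (ℚᵘ.≃-trans (ℚ.toℚᵘ-homo-* C (ℕtoℚ d)) (ℚᵘ.*-congˡ {ℚ.toℚᵘ C} (ℚ.toℚᵘ-fromℚᵘ (ℚᵘ.mkℚᵘ (ℤ.+ d) 0))))
      (ℚ.toℚᵘ-mono-≤ m≤Cd))
  step : ℤ.+ m ℤ.≤ c ℤ.* ℤ.+ d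
  step with ℚᵘ.drop-*≤* unnormalised
  ... | le = ℤ.≤-trans (ℤ.+≤+ (m≤m*n m (suc (e-1 * 1)))) (subst₂ ℤ._≤_ (sym (ℤ.pos-* m _)) (ℤ.*-identityʳ _) le)
  step′ : c ℤ.* ℤ.+ d ℤ.≤ ℤ.+ ∣ c ∣ ℤ.* ℤ.+ d
  step′ = ℤ.*-monoʳ-≤-nonNeg (ℤ.+ d) (i≤∣i∣ c)
    where
    i≤∣i∣ : ∀ i → i ℤ.≤ ℤ.+ ∣ i ∣
    i≤∣i∣ (ℤ.+ _)    = ℤ.≤-refl
    i≤∣i∣ -[1+ _ ] = ℤ.-≤+

module _ {n} (D : Digraph n) where

  IsWalk : (ℕ → Fin n) → Set
  IsWalk w = ∀ t → T (arc D (w t) (w (suc t)))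

  -- Strong induction on `m`: a repetition inside the closed walk yields a shorter closed walk, and
  -- without one the closed walk is itself a cycle.
  repetition⇒cycle : ∀ w → IsWalk w → ∀ m a → w a ≡ w (a + suc m) →
                     ∃ λ k → k ≤ suc m × HasCycleOfLength D k
  repetition⇒cycle w walk = <-rec _ go
    where
    go : ∀ m → (∀ {m′} → m′ < m → ∀ a → w a ≡ w (a + suc m′) → ∃ λ k → k ≤ suc m′ × HasCycleOfLength D k) →
         ∀ a → w a ≡ w (a + suc m) → ∃ λ k → k ≤ suc m × HasCycleOfLength D k
    -- The search covers times `a` to `a + m`; time `a + suc m` is left out, as it repeats `a`.
    go m rec a wa≡ with any? (λ (i : Fin (suc m)) → any? (λ j → (i <ᶠ? j) ×-dec (w (a + toℕ i) ≟ᶠ w (a + toℕ j))))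
    ... | yes (i , j , i<j , eq) = shorter (rec m′<m (a + toℕ i) (trans eq (cong w (sym a+i+1+m′))))
      where
      m′ = toℕ j ∸ suc (toℕ i)
      j≡ : toℕ i + suc m′ ≡ toℕ j
      j≡ = trans (+-suc (toℕ i) m′) (m+[n∸m]≡n i<j)
      a+i+1+m′ : a + toℕ i + suc m′ ≡ a + toℕ j
      a+i+1+m′ = trans (+-assoc a (toℕ i) (suc m′)) (cong (a +_) j≡)
      m′<m : m′ < m
      m′<m = ≤-pred (≤-trans (s≤s (≤-trans (m≤n+m (suc m′) (toℕ i)) (≤-reflexive j≡))) (toℕ<n j))
      shorter : (∃ λ k → k ≤ suc m′ × HasCycleOfLength D k) → ∃ λ k → k ≤ suc m × HasCycleOfLength D k
      shorter (k , k≤ , cyc) = k , ≤-trans k≤ (m≤n⇒m≤1+n m′<m) , cyc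
    ... | no ¬rep = suc m , ≤-refl , p , inj , arcs , closing
      where
      p : Fin (suc m) → Fin n
      p i = w (a + toℕ i)
      inj : ∀ {i j} → p i ≡ p j → i ≡ j
      inj {i} {j} eq with <ᶠ-cmp i j
      ... | tri< i<j _ _ = ⊥-elim (¬rep (i , j , i<j , eq))
      ... | tri≈ _ i≡j _ = i≡j
      ... | tri> _ _ j<i = ⊥-elim (¬rep (j , i , j<i , sym eq))
      arcs : ∀ (i : Fin m) → T (arc D (p (inject₁ i)) (p (suc i)))
      arcs i = subst₂ (λ x y → T (arc D (w x) (w y))) (cong (a +_) (sym (toℕ-inject₁ i))) (sym (+-suc a (toℕ i))) (walk (a + toℕ i))
      closing : T (arc D (p (fromℕ m)) (p zero))
      closing = subst₂ (λ x y → T (arc D x y)) (cong (λ z → w (a + z)) (sym (toℕ-fromℕ m)))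
        (trans (cong w (sym (+-suc a m))) (trans (sym wa≡) (cong w (sym (+-identityʳ a))))) (walk (a + m))

  Rainbow : ∀ {k} → (Fin n → Fin k) → Set
  Rainbow φ = ∀ v i → ∃ λ w → T (arc D v w) × φ w ≡ i

  -- The girth bound is `suc g`, so the path has `suc j * suc g` vertices and one arc fewer.
  rainbow⇒path : ∀ {j g} (φ : Fin n → Fin (suc j)) → Rainbow φ →
                 (∀ k → HasCycleOfLength D k → suc g ≤ k) → Fin n → HasPath D (g + j * suc g)
  rainbow⇒path {j} {g} φ rainbow girth v₀ = p , inj , arcs
    where
    -- The remainder makes `colour` total; it does not wrap around during the first `suc j * suc g`
    -- steps.
    colour : ℕ → Fin (suc j)
    colour t = (t / suc g) mod suc j
    w : ℕ → Fin n
    -- The colour of `v₀` is arbitrary, so the walk starts at an out-neighbour of the first colour.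
    w zero    = proj₁ (rainbow v₀ (colour 0))
    w (suc t) = proj₁ (rainbow (w t) (colour (suc t)))
    walk : IsWalk w
    walk t = proj₁ (proj₂ (rainbow (w t) (colour (suc t))))
    φ∘w : ∀ t → φ (w t) ≡ colour t
    φ∘w zero    = proj₂ (proj₂ (rainbow v₀ (colour 0)))
    φ∘w (suc t) = proj₂ (proj₂ (rainbow (w t) (colour (suc t))))
    toℕ-colour : ∀ {t} → t < suc j * suc g → toℕ (colour t) ≡ t / suc g
    toℕ-colour {t} t< = trans (toℕ-fromℕ< _) (m<n⇒m%n≡m (m<n*o⇒m/o<n {t} {suc j} {suc g} t<))
    no-repetition : ∀ {a b} → a < b → b < suc j * suc g → w a ≢ w b
    no-repetition {a} {b} a<b b< wa≡wb = absurd (repetition⇒cycle w walk m a (trans wa≡wb (cong w (sym b≡))))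
      where
      m = b ∸ suc a
      b≡ : a + suc m ≡ b
      b≡ = trans (+-suc a m) (m+[n∸m]≡n a<b)
      same-block : a / suc g ≡ b / suc g
      same-block = trans (sym (toℕ-colour (<-trans a<b b<)))
        (trans (cong toℕ (trans (sym (φ∘w a)) (trans (cong φ wa≡wb) (φ∘w b)))) (toℕ-colour b<))
      -- Two times in the same block of `suc g` steps differ by less than `suc g`.
      1+m<1+g : suc m < suc g
      1+m<1+g = +-cancelʳ-< (b / suc g * suc g) _ _ (begin-strict
        suc m + b / suc g * suc g     ≡⟨ +-comm (suc m) _ ⟩
        b / suc g * suc g + suc m     ≡⟨ cong (λ z → z * suc g + suc m) same-block ⟨
        a / suc g * suc g + suc m     ≤⟨ +-monoˡ-≤ (suc m) (m≤n+m (a / suc g * suc g) (a % suc g)) ⟩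
        a % suc g + a / suc g * suc g + suc m ≡⟨ cong (_+ suc m) (m≡m%n+[m/n]*n a (suc g)) ⟨
        a + suc m                     ≡⟨ b≡ ⟩
        b                             ≡⟨ m≡m%n+[m/n]*n b (suc g) ⟩
        b % suc g + b / suc g * suc g <⟨ +-monoˡ-< (b / suc g * suc g) (m%n<n b (suc g)) ⟩
        suc g + b / suc g * suc g     ∎)
        where open ≤-Reasoning
      absurd : (∃ λ k → k ≤ suc m × HasCycleOfLength D k) → ⊥
      absurd (k , k≤ , cyc) = <⇒≱ (≤-trans (s≤s k≤) 1+m<1+g) (girth k cyc)
    p : Fin (suc (g + j * suc g)) → Fin n
    p i = w (toℕ i)
    inj : ∀ {i i′} → p i ≡ p i′ → i ≡ i′
    inj {i} {i′} eq with <-cmp (toℕ i) (toℕ i′)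
    ... | tri< lt _ _  = ⊥-elim (no-repetition lt (toℕ<n i′) eq)
    ... | tri≈ _ eq′ _ = toℕ-injective eq′
    ... | tri> _ _ gt  = ⊥-elim (no-repetition gt (toℕ<n i) (sym eq))
    arcs : ∀ (i : Fin (g + j * suc g)) → T (arc D (p (inject₁ i)) (p (suc i)))
    arcs i = subst (λ x → T (arc D (w x) (w (suc (toℕ i))))) (sym (toℕ-inject₁ i)) (walk (toℕ i))

-- Trimmed out-neighbourhoods, overlaps and the final bound

indicator>0⇒true : ∀ b → 0 < indicator b → b ≡ true
indicator>0⇒true true _ = refl

indicator-mono : ∀ {b c} → (b ≡ true → c ≡ true) → indicator b ≤ indicator c
indicator-mono {false}     b⇒c = z≤n
indicator-mono {true}  {c} b⇒c = ≤-reflexive (cong indicator (sym (b⇒c refl)))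

-- Out-degrees are bounded only from below; keeping exactly `d` out-neighbours limits the overlaps
-- and fixes the failure probability.
subset-of-size : ∀ {n} d (U : Fin n → Bool) → d ≤ size U →
  ∃ λ V → size V ≡ d × (∀ w → V w ≡ true → U w ≡ true)
subset-of-size {n}     zero    U d≤ = (λ _ → false) , sum-replicate-zero n , λ _ ()
subset-of-size {suc n} (suc d) U d≤ with U zero in U0
... | true  = let V , size-V , V⊆U = subset-of-size d (U ∘ suc) (≤-pred d≤)
              in true ∷ᶠ V , cong suc size-V , λ { zero _ → U0 ; (suc w) → V⊆U w }
... | false = let V , size-V , V⊆U = subset-of-size (suc d) (U ∘ suc) d≤
              in false ∷ᶠ V , size-V , λ { zero () ; (suc w) → V⊆U w }

another-element : ∀ {n} (U : Fin n → Bool) v → 2 ≤ size U → ∃ λ w → w ≢ v × U w ≡ true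
another-element U zero 2≤ =
  let w , pos = sum>0⇒∃>0 (indicator ∘ U ∘ suc) (≤-pred (≤-trans 2≤ (+-monoˡ-≤ _ (indicator≤1 (U zero)))))
  in suc w , (λ ()) , indicator>0⇒true (U (suc w)) pos
  where
  indicator≤1 : ∀ b → indicator b ≤ 1
  indicator≤1 false = z≤n
  indicator≤1 true  = ≤-refl
another-element U (suc v) 2≤ with U zero in U0
... | true  = zero , (λ ()) , U0
... | false = let w , w≢v , Uw = another-element (U ∘ suc) v 2≤ in suc w , w≢v ∘ sucᶠ-injective , Uw

-- Double counting of the configurations `v → w ← u`: `d` choices for `w`, then at most `K` for `u`.
sum-shared≤ : ∀ {n d K} (V : Fin n → Fin n → Bool) → (∀ v → size (V v) ≡ d) →
  (∀ w → sum (λ u → indicator (V u w)) ≤ K) → ∀ v → sum (λ u → shared (V v) (V u)) ≤ d * K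
sum-shared≤ {n} {d} {K} V sizes indegrees v = begin
  sum (λ u → sum (λ w → indicator (V v w) * indicator (V u w)))
    ≡⟨ ∑-comm {n} {n} (λ u w → indicator (V v w) * indicator (V u w)) ⟩
  sum (λ w → sum (λ u → indicator (V v w) * indicator (V u w)))
    ≡⟨ sum-cong-≗ {n} (λ w → *-distribˡ-sum {n} (indicator (V v w)) (λ u → indicator (V u w))) ⟨
  sum (λ w → indicator (V v w) * sum (λ u → indicator (V u w)))
    ≤⟨ sum-mono-≤ (λ w → *-monoʳ-≤ (indicator (V v w)) (indegrees w)) ⟩
  sum (λ w → indicator (V v w) * K)
    ≡⟨ *-distribʳ-sum {n} K (indicator ∘ V v) ⟨
  size (V v) * K
    ≡⟨ cong (_* K) (sizes v) ⟩
  d * K ∎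
  where open ≤-Reasoning

rainbow-colouring : ∀ {n} (D : Digraph n) j d K → 0 < d * K →
  (∀ v → d ≤ outdeg D v) → (∀ v → indeg D v ≤ K) →
  2 * (2 * (d * K)) * (suc j * j ^ d) ≤ suc j ^ d →
  ∃ λ (φ : Fin n → Fin (suc j)) → Rainbow D φ
rainbow-colouring {n} D j d K 0<dK out in≤ rare =
  let φ , hits = exists-colouring (sum-shared≤ V size-V indegrees)
  in φ , λ v i → let w , Vw , φw = hits v i in w , Equivalence.from T-≡ (V⊆out v w Vw) , φw
  where
  trimmed : ∀ v → ∃ λ V → size V ≡ d × (∀ w → V w ≡ true → arc D v w ≡ true)
  trimmed v = subset-of-size d (arc D v) (subst (d ≤_) (sum-allFin n (indicator ∘ arc D v)) (out v))
  V : Fin n → Fin n → Bool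
  V v = proj₁ (trimmed v)
  size-V : ∀ v → size (V v) ≡ d
  size-V v = proj₁ (proj₂ (trimmed v))
  V⊆out : ∀ v w → V v w ≡ true → arc D v w ≡ true
  V⊆out v = proj₂ (proj₂ (trimmed v))
  indegrees : ∀ w → sum (λ u → indicator (V u w)) ≤ K
  indegrees w = begin
    sum (λ u → indicator (V u w))      ≤⟨ sum-mono-≤ (λ u → indicator-mono (V⊆out u w)) ⟩
    sum (λ u → indicator (arc D u w))  ≡⟨ sum-allFin n (λ u → indicator (arc D u w)) ⟨
    indeg D w                          ≤⟨ in≤ w ⟩
    K                                  ∎
    where open ≤-Reasoning
  1+pred : suc (pred (2 * (d * K))) ≡ 2 * (d * K)
  1+pred = suc-pred (2 * (d * K)) {{>-nonZero (≤-trans 0<dK (m≤m+n _ _))}}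
  open Colourings j
  open LocalLemma V d (d * K) (pred (2 * (d * K))) size-V 1+pred
    (subst (λ z → 2 * z * (suc j * j ^ d) ≤ suc j ^ d) (sym 1+pred) rare)

-- A loop accounts for only one out-neighbour, so a second one differs from `v`.
arc-path : ∀ {n} (D : Digraph n) v → 2 ≤ outdeg D v → HasPath D 1
arc-path {n} D v 2≤ =
  let w , w≢v , vw = another-element (arc D v) v (subst (2 ≤_) (sum-allFin n (indicator ∘ arc D v)) 2≤)
      p : Fin 2 → Fin n
      p = λ { zero → v ; (suc _) → w }
  in p , (λ { {zero} {zero} _ → refl ; {zero} {suc zero} eq → contradiction (sym eq) w≢v
            ; {suc zero} {zero} eq → contradiction eq w≢v ; {suc zero} {suc zero} _ → refl })
       , λ { zero → Equivalence.from T-≡ vw }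

-- A path on `suc j * g` vertices has one arc fewer. Doubling its length makes up for that, unless
-- the path is a single vertex; a single arc then replaces it.
long-path : ∀ {n} (D : Digraph n) {j g} (φ : Fin n → Fin (suc j)) → Rainbow D φ →
  (∀ v → 2 ≤ outdeg D v) → Girth D g → ∃ λ L → HasPath D L × suc j * g ≤ 2 * L
long-path D {g = zero} φ rainbow out (() , _)
long-path {n} D {j} {suc g} φ rainbow out ((c , _) , girth) = go (g + j * suc g) (rainbow⇒path D φ rainbow girth (c zero))
  where
  go : ∀ L → HasPath D L → ∃ λ L′ → HasPath D L′ × suc L ≤ 2 * L′
  go zero    _    = 1 , arc-path D (c zero) (out (c zero)) , s≤s z≤n
  go (suc L) path = suc L , path , s≤s (≤-trans (m≤n+m (suc L) L) (+-monoʳ-≤ L (m≤m+n (suc L) 0)))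

-- The bound is exponentiated: `(p / q) ^ (d * g) ≤ d ^ L` means `L ≥ c d g / log d` with
-- `c = log (p / q)`, positive as `q < p`.
theorem3 : ∀ (C : ℚ) → 0ℚ <ℚ C →
    Σ ℕ λ p → Σ ℕ λ q → (0 < q) × (q < p) ×
    (∀ (d n g : ℕ) (D : Digraph n) → 2 ≤ d → Regular C d D → Girth D g →
    Σ ℕ λ L → HasPath D L × (p ^ (d * g) ≤ (d ^ L) * (q ^ (d * g))))
theorem3 C _ = suc q , q , z<s , ≤-refl , bound
  where
  a = ∣ ℚ.numerator C ∣
  m = 4 * (8 + a)
  -- Chosen so that `suc q = 2 * m`, whence `(suc q / q) ^ m ≤ 2`.
  q = 63 + 8 * a
  1+q≡2m : ∀ a → 64 + 8 * a ≡ 2 * (4 * (8 + a))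
  1+q≡2m = solve-∀
  bound : ∀ (d n g : ℕ) (D : Digraph n) → 2 ≤ d → Regular C d D → Girth D g →
    Σ ℕ λ L → HasPath D L × (suc q ^ (d * g) ≤ (d ^ L) * (q ^ (d * g)))
  bound d n g D 2≤d regular girth = L , path , (begin
    suc q ^ (d * g)             ≤⟨ p^e≤2^s*q^e m (ℓ * L) (d * g) z<s (n≤1+n q) ([2m]^m≤2*[2m-1]^m q m (1+q≡2m a)) dg≤ ⟩
    2 ^ (ℓ * L) * q ^ (d * g)   ≡⟨ cong (_* q ^ (d * g)) (^-*-assoc 2 ℓ L) ⟨
    (2 ^ ℓ) ^ L * q ^ (d * g)   ≤⟨ *-monoˡ-≤ (q ^ (d * g)) (^-monoˡ-≤ L 2^ℓ≤d) ⟩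
    d ^ L * q ^ (d * g)         ∎)
    where
    open ≤-Reasoning
    -- The bound `a` on `C` is enlarged to a power of two, which `number-of-colours` absorbs into
    -- its exponent.
    K = 2 ^ a * d
    colours = number-of-colours a d 2≤d
    ℓ = proj₁ colours
    j = proj₁ (proj₂ colours)
    2^ℓ≤d = proj₁ (proj₂ (proj₂ colours))
    d≤ = proj₁ (proj₂ (proj₂ (proj₂ colours)))
    rare = proj₂ (proj₂ (proj₂ (proj₂ colours)))
    0<d : 0 < d
    0<d = <⇒≤ 2≤d
    in≤K : ∀ v → indeg D v ≤ K
    in≤K v = ≤-trans (ℕtoℚ-bound C (indeg D v) d (proj₂ (regular v))) (*-monoˡ-≤ d (<⇒≤ (n<2^n a)))
    colouring = rainbow-colouring D j d K (*-mono-≤ 0<d (*-mono-≤ (m^n>0 2 a) 0<d)) (proj₁ ∘ regular) in≤K rare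
    long = long-path D (proj₁ colouring) (proj₂ colouring) (λ v → ≤-trans 2≤d (proj₁ (regular v))) girth
    L = proj₁ long
    path = proj₁ (proj₂ long)
    -- With `k = suc j` colours, `d ≤ (m / 2) * ℓ * k` and `k * g ≤ 2 * L` are combined.
    dg≤ : d * g ≤ m * (ℓ * L)
    dg≤ = begin
      d * g                               ≤⟨ *-monoˡ-≤ g d≤ ⟩
      2 * (8 + a) * ℓ * suc j * g         ≡⟨ *-assoc (2 * (8 + a) * ℓ) (suc j) g ⟩
      2 * (8 + a) * ℓ * (suc j * g)       ≤⟨ *-monoʳ-≤ (2 * (8 + a) * ℓ) (proj₂ (proj₂ long)) ⟩
      2 * (8 + a) * ℓ * (2 * L)           ≡⟨ regroup a ℓ L ⟩
      m * (ℓ * L)                         ∎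
      where
      regroup : ∀ a l L → 2 * (8 + a) * l * (2 * L) ≡ 4 * (8 + a) * (l * L)
      regroup = solve-∀
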